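{- Let $k$ and $n$ be positive integers. The number $\widetilde{b}_k(n)$ of minimal bridges from $(0,0)$ to $(kn,n)$ is $$\widetilde{b}_k(n)=\frac{k}{kn+n-1}\binom{kn+n}{n}.$$
   Context: A bridge of size $n$ (with respect to the line $y=x/k$) is a lattice path from $(0,0)$ to $(kn,n)$ composed only of unit steps to the right $(1,0)$ and up $(0,1)$. A minimal bridge is a nontrivial bridge that contains no lattice points on the line $y=x/k$ other than its two endpoints. -}

module Defs where

open import Data.Nat using (ℕ; zero; suc; _+_; _*_; _∸_; NonZero; >-nonZero; >-nonZero⁻¹)
open import Data.Nat.Properties
  using (_≟_; +-suc; +-identityʳ; +-mono-≤; m*n≢0; m<n⇒0<n∸m)
open import Data.List using (List; []; _∷_; _++_; map; filter; length; foldl)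
open import Data.List.Properties using (≡-dec; ∷-injectiveʳ)
open import Data.List.Scans.Base using (scanl)
open import Data.List.Membership.Propositional using (_∈_)
open import Data.List.Membership.Propositional.Properties
  using (∈-map⁺; ∈-map⁻; ∈-++⁺ˡ; ∈-++⁺ʳ; ∈-filter⁺; ∈-filter⁻)
open import Data.List.Relation.Unary.All using (All; all?; [])
open import Data.List.Relation.Unary.Any using (here)
open import Data.List.Relation.Unary.AllPairs using ([]; _∷_)
open import Data.List.Relation.Unary.Unique.Propositional using (Unique)
import Data.List.Relation.Unary.Unique.Propositional.Properties as Unique
open import Data.Product using (_×_; _,_; proj₁; proj₂)
open import Data.Product.Properties using () renaming (≡-dec to ×-≡-dec)
open import Data.Sum using (_⊎_)
open import Function using (_⇔_; mk⇔)
open import Relation.Binary.Definitions using (DecidableEquality)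
open import Relation.Binary.PropositionalEquality
  using (_≡_; _≢_; refl; sym; trans; cong; subst)
open import Relation.Nullary using (Dec; yes; no)
open import Relation.Nullary.Decidable using (¬?; _×-dec_; _⊎-dec_; _→-dec_)

Point : Set
Point = ℕ × ℕ

origin : Point
origin = 0 , 0

data Step : Set where
  right up : Step

move : Point → Step → Point
move (x , y) right = suc x , y
move (x , y) up    = x , suc y

-- Paths start at the origin and are given by their steps.
Path : Set
Path = List Step

endpoint : Path → Point
endpoint = foldl move origin

-- All the lattice points of a path, its two endpoints included.
vertices : Path → List Point
vertices = scanl move origin

-- The line y = x / k, for k positive.
OnLine : ℕ → Point → Set
OnLine k (x , y) = x ≡ k * y

IsBridge : ℕ → ℕ → Path → Set
IsBridge k n w = endpoint w ≡ (k * n , n)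

IsMinimalBridge : ℕ → ℕ → Path → Set
IsMinimalBridge k n w =
  w ≢ [] ×
  IsBridge k n w ×
  All (λ p → OnLine k p → p ≡ origin ⊎ p ≡ (k * n , n)) (vertices w)

_≟ˢ_ : DecidableEquality Step
right ≟ˢ right = yes refl
right ≟ˢ up    = no λ ()
up    ≟ˢ right = no λ ()
up    ≟ˢ up    = yes refl

_≟ᵖ_ : DecidableEquality Point
_≟ᵖ_ = ×-≡-dec _≟_ _≟_

isMinimalBridge? : ∀ k n w → Dec (IsMinimalBridge k n w)
isMinimalBridge? k n w =
  ¬? (≡-dec _≟ˢ_ w []) ×-dec
  (endpoint w ≟ᵖ (k * n , n)) ×-dec
  all? (λ { p@(x , y) → (x ≟ k * y) →-dec ((p ≟ᵖ origin) ⊎-dec (p ≟ᵖ (k * n , n))) })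
       (vertices w)

pathsOfLength : ℕ → List Path
pathsOfLength zero    = [] ∷ []
pathsOfLength (suc m) =
  map (right ∷_) (pathsOfLength m) ++ map (up ∷_) (pathsOfLength m)

-- A path ending at (k * n , n) has exactly k * n + n steps; see ∈-minimalBridges.
minimalBridges : ℕ → ℕ → List Path
minimalBridges k n = filter (isMinimalBridge? k n) (pathsOfLength (k * n + n))

b̃ : ℕ → ℕ → ℕ
b̃ k n = length (minimalBridges k n)

-- minimalBridges lists every minimal bridge exactly once.

∈-pathsOfLength : ∀ w → w ∈ pathsOfLength (length w)
∈-pathsOfLength []          = here refl
∈-pathsOfLength (right ∷ w) = ∈-++⁺ˡ (∈-map⁺ (right ∷_) (∈-pathsOfLength w))
∈-pathsOfLength (up ∷ w)    = ∈-++⁺ʳ _ (∈-map⁺ (up ∷_) (∈-pathsOfLength w))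

pathsOfLength-unique : ∀ m → Unique (pathsOfLength m)
pathsOfLength-unique zero    = [] ∷ []
pathsOfLength-unique (suc m) =
  Unique.++⁺ (Unique.map⁺ ∷-injectiveʳ (pathsOfLength-unique m))
             (Unique.map⁺ ∷-injectiveʳ (pathsOfLength-unique m))
             disjoint
  where
  disjoint : ∀ {w} → w ∈ map (right ∷_) (pathsOfLength m)
                   × w ∈ map (up ∷_) (pathsOfLength m) → _
  disjoint (p , q) with ∈-map⁻ (right ∷_) p | ∈-map⁻ (up ∷_) q
  ... | _ , _ , refl | _ , _ , ()

coordinateSum : Point → ℕ
coordinateSum (x , y) = x + y

coordinateSum-foldl : ∀ p w → coordinateSum (foldl move p w) ≡ coordinateSum p + length w
coordinateSum-foldl p       []          = sym (+-identityʳ _)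
coordinateSum-foldl (x , y) (right ∷ w) =
  trans (coordinateSum-foldl (suc x , y) w) (sym (+-suc (x + y) (length w)))
coordinateSum-foldl (x , y) (up ∷ w)    =
  trans (coordinateSum-foldl (x , suc y) w)
        (trans (cong (_+ length w) (+-suc x y)) (sym (+-suc (x + y) (length w))))

bridge-length : ∀ k n w → IsBridge k n w → length w ≡ k * n + n
bridge-length k n w e = trans (sym (coordinateSum-foldl origin w)) (cong coordinateSum e)

∈-minimalBridges : ∀ k n w → w ∈ minimalBridges k n ⇔ IsMinimalBridge k n w
∈-minimalBridges k n w = mk⇔
  (λ i → proj₂ (∈-filter⁻ (isMinimalBridge? k n) {xs = pathsOfLength (k * n + n)} i))
  (λ b → ∈-filter⁺ (isMinimalBridge? k n)
    (subst (λ m → w ∈ pathsOfLength m)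
           (bridge-length k n w (proj₁ (proj₂ b)))
           (∈-pathsOfLength w))
    b)

minimalBridges-unique : ∀ k n → Unique (minimalBridges k n)
minimalBridges-unique k n =
  Unique.filter⁺ (isMinimalBridge? k n) (pathsOfLength-unique (k * n + n))

kn+n∸1≢0 : ∀ k n .{{_ : NonZero k}} .{{_ : NonZero n}} → NonZero (k * n + n ∸ 1)
kn+n∸1≢0 k n = >-nonZero (m<n⇒0<n∸m (+-mono-≤ (>-nonZero⁻¹ (k * n) {{m*n≢0 k n}}) (>-nonZero⁻¹ n)))

{-# OPTIONS --safe #-}
module Submission where

-- Let a point (x , y) have height x − k y: right steps raise it by 1 and up
-- steps lower it by k. A minimal bridge can jump over the line downwards but
-- not upwards, so it stays above the line until a single jump from some height
-- i to i − k, where 0 ≤ i ≤ k, and below the line from then on. Reversing the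
-- part above the line and lowering it by k − i turns it into a first passage
-- from −k to −(k − i), which the part below the line completes to a first
-- passage from −k to 0. Hence each of the k + 1 values of i accounts for as many
-- minimal bridges as there are first passages from −k to 0 in k n + n − 1 steps,
-- and the ballot theorem counts these.

open import Defs
open import Data.Nat using (ℕ; zero; suc; NonZero; _+_; _∸_; _<_; _≤_; z≤n; s≤s; s<s⁻¹)
  renaming (_*_ to _*ℕ_)
open import Data.Nat.Properties
open import Data.Nat.Combinatorics
  using (_C_; nCk+nC[k+1]≡[n+1]C[k+1]; k>n⇒nCk≡0; nC1≡n; nCk≡nC[n∸k]; nCn≡1)
open import Data.Nat.Tactic.RingSolver using (solve-∀)
import Algebra.Properties.CommutativeSemigroup +-commutativeSemigroup as +
import Algebra.Properties.CommutativeSemigroup *-commutativeSemigroup as *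
import Data.Integer as ℤ
import Data.Integer.Properties as ℤ
open import Data.List using ([]; _∷_; _++_; map; filter; length; foldl)
open import Data.List.Properties
  using (length-++; filter-++; filter-≐; filter-accept; filter-none)
open import Data.List.Scans.Base using (scanl)
open import Data.List.Relation.Unary.All using (All; []; _∷_; universal)
open import Data.Product using (_×_; _,_; proj₁; proj₂)
open import Data.Rational using (_/_; _*_; toℚᵘ)
open import Data.Rational.Properties using (toℚᵘ-injective; toℚᵘ-fromℚᵘ; toℚᵘ-homo-*)
import Data.Rational.Unnormalised as ℚᵘ
import Data.Rational.Unnormalised.Properties as ℚᵘ
open import Data.Sum using (_⊎_; inj₁; inj₂)
open import Function using (_∘_)
open import Relation.Binary.PropositionalEquality
open import Relation.Nullary using (¬_; yes; no; contradiction)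
open import Relation.Nullary.Decidable using (map′; does)
open import Relation.Unary using (Pred; Decidable; _≐_)
open import Data.Bool using (true; false)
open import Level using (0ℓ)

open ≡-Reasoning

-- Sums over antidiagonals and truncated inner products.

-- Summed over i + j + 1 = m, so antidiagonal F 0 is an empty sum.
antidiagonal : (ℕ → ℕ → ℕ) → ℕ → ℕ
antidiagonal F zero    = 0
antidiagonal F (suc m) = F 0 m + antidiagonal (F ∘ suc) m

antidiagonal-cong : ∀ {F G} m → (∀ i j → suc (i + j) ≡ m → F i j ≡ G i j) →
  antidiagonal F m ≡ antidiagonal G m
antidiagonal-cong zero    F≡G = refl
antidiagonal-cong (suc m) F≡G =
  cong₂ _+_ (F≡G 0 m refl) (antidiagonal-cong m (λ i j e → F≡G (suc i) j (cong suc e)))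

antidiagonal-const : ∀ c m → antidiagonal (λ _ _ → c) m ≡ m *ℕ c
antidiagonal-const c zero    = refl
antidiagonal-const c (suc m) = cong (c +_) (antidiagonal-const c m)

antidiagonal-+ : ∀ F G m →
  antidiagonal (λ i j → F i j + G i j) m ≡ antidiagonal F m + antidiagonal G m
antidiagonal-+ F G zero    = refl
antidiagonal-+ F G (suc m) = trans
  (cong (F 0 m + G 0 m +_) (antidiagonal-+ (F ∘ suc) (G ∘ suc) m))
  (+.interchange (F 0 m) (G 0 m) _ _)

-- Brings the sum over crossing heights outside, so that the sum over times left inside is a
-- convolution.
antidiagonal-swap : ∀ (F : ℕ → ℕ → ℕ → ℕ → ℕ) k m →
  antidiagonal (λ t u → antidiagonal (F t u) k) m ≡
  antidiagonal (λ i j → antidiagonal (λ t u → F t u i j) m) k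
antidiagonal-swap F k zero    = sym (trans (antidiagonal-const 0 k) (*-zeroʳ k))
antidiagonal-swap F k (suc m) = trans
  (cong (antidiagonal (F 0 m) k +_) (antidiagonal-swap (F ∘ suc) k m))
  (sym (antidiagonal-+ (F 0 m) _ k))

-- Used with f counting the ways to arrive at each height and g the ways to go on from there.
dot : ℕ → (ℕ → ℕ) → (ℕ → ℕ) → ℕ
dot zero    f g = 0
dot (suc H) f g = f 0 *ℕ g 0 + dot H (f ∘ suc) (g ∘ suc)

dot-congˡ : ∀ {f f′} H g → (∀ h → f h ≡ f′ h) → dot H f g ≡ dot H f′ g
dot-congˡ zero    g f≡f′ = refl
dot-congˡ (suc H) g f≡f′ =
  cong₂ _+_ (cong (_*ℕ g 0) (f≡f′ 0)) (dot-congˡ H (g ∘ suc) (f≡f′ ∘ suc))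

dot-+ˡ : ∀ H f f′ g → dot H (λ h → f h + f′ h) g ≡ dot H f g + dot H f′ g
dot-+ˡ zero    f f′ g = refl
dot-+ˡ (suc H) f f′ g = trans
  (cong₂ _+_ (*-distribʳ-+ (g 0) (f 0) (f′ 0)) (dot-+ˡ H (f ∘ suc) (f′ ∘ suc) (g ∘ suc)))
  (+.interchange (f 0 *ℕ g 0) (f′ 0 *ℕ g 0) _ _)

dot-+ʳ : ∀ H f g g′ → dot H f (λ h → g h + g′ h) ≡ dot H f g + dot H f g′
dot-+ʳ zero    f g g′ = refl
dot-+ʳ (suc H) f g g′ = trans
  (cong₂ _+_ (*-distribˡ-+ (f 0) (g 0) (g′ 0)) (dot-+ʳ H (f ∘ suc) (g ∘ suc) (g′ ∘ suc)))
  (+.interchange (f 0 *ℕ g 0) (f 0 *ℕ g′ 0) _ _)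

dot-zeroʳ : ∀ H f → dot H f (λ _ → 0) ≡ 0
dot-zeroʳ zero    f = refl
dot-zeroʳ (suc H) f = cong₂ _+_ (*-zeroʳ (f 0)) (dot-zeroʳ H (f ∘ suc))

dot-extend : ∀ H d f g → (∀ h → H ≤ h → f h ≡ 0) → dot H f g ≡ dot (H + d) f g
dot-extend zero    zero    f g f≡0 = refl
dot-extend zero    (suc d) f g f≡0 =
  cong₂ _+_ (sym (cong (_*ℕ g 0) (f≡0 0 z≤n)))
            (dot-extend zero d (f ∘ suc) (g ∘ suc) (λ h _ → f≡0 (suc h) z≤n))
dot-extend (suc H) d f g f≡0 =
  cong (f 0 *ℕ g 0 +_) (dot-extend H d (f ∘ suc) (g ∘ suc) (λ h p → f≡0 (suc h) (s≤s p)))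

-- glue k f g h is g (h - k) for h ≥ k, and f (k - 1 - h) for h < k.
glue : ℕ → (ℕ → ℕ) → (ℕ → ℕ) → ℕ → ℕ
glue zero    f g h       = g h
glue (suc k) f g zero    = f k
glue (suc k) f g (suc h) = glue k f g h

-- Entries below k meet f in reversed order: a jump from height i + 1 lands at height -j with i + 1
-- + j = k.
dot-glue : ∀ k H a f g →
  dot (k + H) a (glue k f g) ≡ antidiagonal (λ i j → a i *ℕ f j) k + dot H (λ h → a (k + h)) g
dot-glue zero    H a f g = refl
dot-glue (suc k) H a f g = trans
  (cong (a 0 *ℕ f k +_) (dot-glue k H (a ∘ suc) f g))
  (sym (+-assoc (a 0 *ℕ f k) _ _))

-- Recursive path counts and the reversal argument.

module _ (k : ℕ) where

  -- below m j counts the paths of m steps from a point with x + j = k y that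
  -- meet the line for the first time at their end.
  below : ℕ → ℕ → ℕ
  below zero    zero    = 1
  below zero    (suc j) = 0
  below (suc m) zero    = 0
  below (suc m) (suc j) = below m j + below m (suc j + k)

  -- above m h counts those from a point with x = k y + (h + 1); since the line
  -- can be jumped over from above, they may continue below it.
  above : ℕ → ℕ → ℕ
  above zero    h = 0
  above (suc m) h = above m (suc h) + glue k (below m) (above m) h

  -- No step lowers j by more than one.
  below-vanishes : ∀ m j → m < j → below m j ≡ 0
  below-vanishes zero    (suc j) _ = refl
  below-vanishes (suc m) (suc j) p = cong₂ _+_
    (below-vanishes m j (s<s⁻¹ p))
    (below-vanishes m (suc j + k) (≤-trans p′ (m≤m+n (suc j) k)))
    where
    p′ : m < suc j
    p′ = ≤-trans (n<1+n m) (≤-trans (n≤1+n (suc m)) p)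

  below-diagonal : ∀ m → below m m ≡ 1
  below-diagonal zero    = refl
  below-diagonal (suc m) =
    cong₂ _+_ (below-diagonal m) (below-vanishes m (suc m + k) (m≤m+n (suc m) k))

  -- A first passage from -(i + 1 + j) to 0 splits at its first visit to -j.
  below-convolution : ∀ m i j →
    antidiagonal (λ t u → below (suc t) (suc i) *ℕ below u j) m ≡ below m (suc i + j)
  below-convolution zero    i j = refl
  below-convolution (suc m) i j = begin
    below 1 (suc i) *ℕ below m j +
      antidiagonal (λ t u → (below (suc t) i + below (suc t) (suc i + k)) *ℕ below u j) m
      ≡⟨ cong (below 1 (suc i) *ℕ below m j +_) (trans
          (antidiagonal-cong m (λ t u _ →
            *-distribʳ-+ (below u j) (below (suc t) i) (below (suc t) (suc i + k))))
          (antidiagonal-+ _ _ m)) ⟩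
    below 1 (suc i) *ℕ below m j +
      (antidiagonal (λ t u → below (suc t) i *ℕ below u j) m +
       antidiagonal (λ t u → below (suc t) (suc i + k) *ℕ below u j) m)
      ≡⟨ +-assoc (below 1 (suc i) *ℕ below m j) _ _ ⟨
    below 1 (suc i) *ℕ below m j +
      antidiagonal (λ t u → below (suc t) i *ℕ below u j) m +
      antidiagonal (λ t u → below (suc t) (suc i + k) *ℕ below u j) m
      ≡⟨ cong₂ _+_ (first i) (trans (below-convolution m (i + k) j)
           (cong (λ v → below m (suc v)) (+.xy∙z≈xz∙y i k j))) ⟩
    below m (i + j) + below m (suc i + j + k) ∎
    where
    -- For i = 0 only the leading term survives, since `below (suc t) 0` is 0; for larger i that
    -- term is 0 and the induction hypothesis remains.
    first : ∀ i → below 1 (suc i) *ℕ below m j +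
                  antidiagonal (λ t u → below (suc t) i *ℕ below u j) m ≡ below m (i + j)
    first zero    = trans
      (cong₂ _+_ (+-identityʳ (below m j)) (trans (antidiagonal-const 0 m) (*-zeroʳ m)))
      (+-identityʳ (below m j))
    first (suc i) = below-convolution m i j

  -- By reversal, below (suc s) (suc h) is the number of paths of s steps from
  -- height 1 to height h + 1 that stay above the line; on the right, t + 1 more
  -- steps are made until the line is jumped over, from height i + 1.
  above-sum : ∀ m s H → s < H →
    dot H (λ h → below (suc s) (suc h)) (above m) ≡
    antidiagonal (λ t u → antidiagonal (λ i j → below (suc (s + t)) (suc i) *ℕ below u j) k) m
  above-sum zero    s H s<H = dot-zeroʳ H _
  above-sum (suc m) s H s<H = begin
    dot H (a s) (above (suc m))
      -- Shifting the index adds an entry at 0, which contributes nothing because `below (suc s) 0`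
      -- is 0.
      ≡⟨ dot-+ʳ H (a s) (above m ∘ suc) (glue k (below m) (above m)) ⟩
    dot (suc H) (below (suc s)) (above m) + dot H (a s) (glue k (below m) (above m))
      ≡⟨ cong (λ v → dot (suc H) (below (suc s)) (above m) + v) (begin
           dot H (a s) (glue k (below m) (above m))
             -- By `s < H` all heights reached in s steps lie under the cutoff, which may thus grow
             -- to k + (H + 1) and be split at k.
             ≡⟨ dot-extend H (suc k) (a s) _
                  (λ h H≤h → below-vanishes (suc s) (suc h) (s≤s (≤-trans s<H H≤h))) ⟩
           dot (H + suc k) (a s) (glue k (below m) (above m))
             ≡⟨ cong (λ v → dot v (a s) (glue k (below m) (above m)))
                  (trans (+-suc H k) (+-comm (suc H) k)) ⟩
           dot (k + suc H) (a s) (glue k (below m) (above m))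
             ≡⟨ dot-glue k (suc H) (a s) (below m) (above m) ⟩
           crossing s + dot (suc H) (λ h → a s (k + h)) (above m) ∎) ⟩
    dot (suc H) (below (suc s)) (above m) + (crossing s + dot (suc H) (λ h → a s (k + h)) (above m))
      ≡⟨ +.x∙yz≈y∙xz (dot (suc H) (below (suc s)) (above m)) (crossing s) _ ⟩
    crossing s + (dot (suc H) (below (suc s)) (above m) + dot (suc H) (λ h → a s (k + h)) (above m))
      ≡⟨ cong (crossing s +_) (begin
           dot (suc H) (below (suc s)) (above m) + dot (suc H) (λ h → a s (k + h)) (above m)
             ≡⟨ dot-+ˡ (suc H) (below (suc s)) (λ h → a s (k + h)) (above m) ⟨
           dot (suc H) (λ h → below (suc s) h + a s (k + h)) (above m)
             -- By the recursion of `below`, the two ways to stay above the line make up the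
             -- arrivals after s + 1 steps.
             ≡⟨ dot-congˡ (suc H) (above m) (λ h →
                  cong (λ v → below (suc s) h + below (suc s) (suc v)) (+-comm k h)) ⟩
           dot (suc H) (a (suc s)) (above m)
             ≡⟨ above-sum m (suc s) (suc H) (s≤s s<H) ⟩
           antidiagonal (λ t u → antidiagonal (λ i j → a (suc s + t) i *ℕ below u j) k) m ∎) ⟩
    crossing s + antidiagonal (λ t u → antidiagonal (λ i j → a (suc s + t) i *ℕ below u j) k) m
      ≡⟨ cong₂ (λ v f → antidiagonal (λ i j → a v i *ℕ below m j) k + f) (sym (+-identityʳ s))
           (antidiagonal-cong m (λ t u _ →
             cong (λ v → antidiagonal (λ i j → a v i *ℕ below u j) k) (sym (+-suc s t)))) ⟩
    antidiagonal (λ t u → antidiagonal (λ i j → a (s + t) i *ℕ below u j) k) (suc m) ∎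
    where
    a : ℕ → ℕ → ℕ
    a s h = below (suc s) (suc h)
    crossing : ℕ → ℕ
    crossing s = antidiagonal (λ i j → a s i *ℕ below m j) k

  -- The line can be crossed from heights 1 to k, and by convolution each of them contributes the
  -- same number.
  above≡k*below : ∀ m → above m 0 ≡ k *ℕ below m k
  above≡k*below m = begin
    above m 0
      ≡⟨ sym (trans (+-identityʳ _) (+-identityʳ _)) ⟩
    -- The path of 0 steps is at height 1, counted once by `below 1 1`.
    dot 1 (λ h → below 1 (suc h)) (above m)
      ≡⟨ above-sum m 0 1 (s≤s z≤n) ⟩
    antidiagonal (λ t u → antidiagonal (λ i j → below (suc t) (suc i) *ℕ below u j) k) m
      ≡⟨ antidiagonal-swap (λ t u i j → below (suc t) (suc i) *ℕ below u j) k m ⟩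
    antidiagonal (λ i j → antidiagonal (λ t u → below (suc t) (suc i) *ℕ below u j) m) k
      ≡⟨ antidiagonal-cong k (λ i j e → trans (below-convolution m i j) (cong (below m) e)) ⟩
    antidiagonal (λ _ _ → below m k) k
      ≡⟨ antidiagonal-const (below m k) k ⟩
    k *ℕ below m k ∎

-- Binomial coefficients and the ballot theorem.

nC0≡1 : ∀ n → n C 0 ≡ 1
nC0≡1 n = trans (nCk≡nC[n∸k] {0} {n} z≤n) (nCn≡1 n)

absorption : ∀ m u → suc u *ℕ (suc m C suc u) ≡ suc m *ℕ (m C u)
absorption m       zero    = begin
  1 *ℕ (suc m C 1)    ≡⟨ trans (*-identityˡ _) (nC1≡n (suc m)) ⟩
  suc m               ≡⟨ *-identityʳ (suc m) ⟨
  suc m *ℕ 1          ≡⟨ cong (suc m *ℕ_) (nC0≡1 m) ⟨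
  suc m *ℕ (m C 0)    ∎
absorption zero    (suc u) =
  trans (cong (suc (suc u) *ℕ_) (k>n⇒nCk≡0 {1} {suc (suc u)} (s≤s (s≤s z≤n))))
        (trans (*-zeroʳ (suc (suc u)))
               (sym (cong (1 *ℕ_) (k>n⇒nCk≡0 {0} {suc u} (s≤s z≤n)))))
absorption (suc m) (suc u) = begin
  suc (suc u) *ℕ (suc (suc m) C suc (suc u))
    ≡⟨ cong (suc (suc u) *ℕ_) (nCk+nC[k+1]≡[n+1]C[k+1] (suc m) (suc u)) ⟨
  suc (suc u) *ℕ (x + y)
    ≡⟨ expand (suc u) x y ⟩
  suc u *ℕ x + (x + suc (suc u) *ℕ y)
    ≡⟨ cong₂ (λ v w → v + (x + w)) (absorption m u) (absorption m (suc u)) ⟩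
  suc m *ℕ (m C u) + (x + suc m *ℕ (m C suc u))
    ≡⟨ collect (suc m) (m C u) x (m C suc u) ⟩
  x + suc m *ℕ (m C u + m C suc u)
    ≡⟨ cong (λ v → x + suc m *ℕ v) (nCk+nC[k+1]≡[n+1]C[k+1] m u) ⟩
  suc (suc m) *ℕ x ∎
  where
  x y : ℕ
  x = suc m C suc u
  y = suc m C suc (suc u)
  expand : ∀ a x y → (1 + a) *ℕ (x + y) ≡ a *ℕ x + (x + (1 + a) *ℕ y)
  expand = solve-∀
  collect : ∀ a p x q → a *ℕ p + (x + a *ℕ q) ≡ x + a *ℕ (p + q)
  collect = solve-∀

module _ (k : ℕ) where

  -- below m j = C(m, u) − (k + 1) C(m − 1, u − 1), where u is the number of up
  -- steps: in this form both terms satisfy Pascal's rule along the recursion.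
  below-binomial : ∀ m j u → suc m ≡ j + suc k *ℕ suc u →
    below k (suc m) j + suc k *ℕ (m C u) ≡ suc m C suc u
  -- Here `below` is 0 and m + 1 = (k + 1)(u + 1), so the claim is absorption after cancelling u +
  -- 1.
  below-binomial m zero u e = *-cancelˡ-≡ _ _ (suc u) (begin
    suc u *ℕ (suc k *ℕ (m C u))  ≡⟨ *-assoc (suc u) (suc k) (m C u) ⟨
    suc u *ℕ suc k *ℕ (m C u)    ≡⟨ cong (_*ℕ (m C u)) (trans (*-comm (suc u) (suc k)) (sym e)) ⟩
    suc m *ℕ (m C u)             ≡⟨ absorption m u ⟨
    suc u *ℕ (suc m C suc u)     ∎)
  below-binomial zero (suc j) u e =
    contradiction (trans (suc-injective e) (+-suc j _)) 0≢1+n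
  below-binomial (suc m) (suc j) u e = begin
    below k (suc m) j + x + suc k *ℕ (suc m C u)
      ≡⟨ +-assoc (below k (suc m) j) x _ ⟩
    below k (suc m) j + (x + suc k *ℕ (suc m C u))
      ≡⟨ cong (below k (suc m) j +_) (after-up u e) ⟩
    below k (suc m) j + (suc k *ℕ (m C u) + suc m C u)
      ≡⟨ +-assoc (below k (suc m) j) _ _ ⟨
    below k (suc m) j + suc k *ℕ (m C u) + suc m C u
      ≡⟨ cong (_+ suc m C u) (below-binomial m j u (suc-injective e)) ⟩
    suc m C suc u + suc m C u
      ≡⟨ +-comm (suc m C suc u) _ ⟩
    suc m C u + suc m C suc u
      ≡⟨ nCk+nC[k+1]≡[n+1]C[k+1] (suc m) u ⟩
    suc (suc m) C suc u ∎
    where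
    x : ℕ
    x = below k (suc m) (suc j + k)
    shift : ∀ j k u → j + (1 + k) *ℕ (1 + u) ≡ (1 + j + k) + (1 + k) *ℕ u
    shift = solve-∀
    rearrange : ∀ x k p q → x + (1 + k) *ℕ (p + q) ≡ (1 + k) *ℕ q + (x + (1 + k) *ℕ p)
    rearrange = solve-∀
    -- After an up step u up steps remain. For u = 0 only right steps are left and `below-diagonal`
    -- applies; otherwise induction does.
    after-up : ∀ u → suc (suc m) ≡ suc j + suc k *ℕ suc u →
      x + suc k *ℕ (suc m C u) ≡ suc k *ℕ (m C u) + suc m C u
    after-up zero    e = begin
      x + suc k *ℕ (suc m C 0)
        ≡⟨ cong₂ (λ v w → v + suc k *ℕ w)
             (trans (cong (below k (suc m)) (sym m≡)) (below-diagonal k (suc m))) (nC0≡1 (suc m)) ⟩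
      1 + suc k *ℕ 1
        ≡⟨ +-comm 1 (suc k *ℕ 1) ⟩
      suc k *ℕ 1 + 1
        ≡⟨ cong₂ (λ v w → suc k *ℕ v + w) (nC0≡1 m) (nC0≡1 (suc m)) ⟨
      suc k *ℕ (m C 0) + suc m C 0 ∎
      where
      m≡ : suc m ≡ suc j + k
      m≡ = trans (suc-injective e) (trans (shift j k 0)
             (trans (cong (suc j + k +_) (*-zeroʳ (suc k))) (+-identityʳ _)))
    after-up (suc u) e = begin
      x + suc k *ℕ (suc m C suc u)
        ≡⟨ cong (λ v → x + suc k *ℕ v) (nCk+nC[k+1]≡[n+1]C[k+1] m u) ⟨
      x + suc k *ℕ (m C u + m C suc u)
        ≡⟨ rearrange x k (m C u) (m C suc u) ⟩
      suc k *ℕ (m C suc u) + (x + suc k *ℕ (m C u))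
        ≡⟨ cong (suc k *ℕ (m C suc u) +_)
             (below-binomial m (suc j + k) u (trans (suc-injective e) (shift j k (suc u)))) ⟩
      suc k *ℕ (m C suc u) + suc m C suc u ∎

  -- The ballot theorem: on multiplying `below-binomial` by m, absorption turns its subtracted term
  -- into (k + 1) u C(m, u), and m - (k + 1) u is j.
  first-passage : ∀ m j u → m ≡ j + suc k *ℕ u → m *ℕ below k m j ≡ j *ℕ (m C u)
  first-passage m j zero e = begin
    m *ℕ below k m j  ≡⟨ cong (λ v → m *ℕ below k m v) m≡j ⟨
    m *ℕ below k m m  ≡⟨ cong (m *ℕ_) (trans (below-diagonal k m) (sym (nC0≡1 m))) ⟩
    m *ℕ (m C 0)      ≡⟨ cong (_*ℕ (m C 0)) m≡j ⟩
    j *ℕ (m C 0)      ∎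
    where
    m≡j : m ≡ j
    m≡j = trans e (trans (cong (j +_) (*-zeroʳ (suc k))) (+-identityʳ j))
  first-passage zero    j (suc u) e = contradiction (trans e (+-suc j _)) 0≢1+n
  first-passage (suc m) j (suc u) e = +-cancelʳ-≡ (suc k *ℕ suc u *ℕ c) _ _ (begin
    suc m *ℕ b + suc k *ℕ suc u *ℕ c
      ≡⟨ cong (suc m *ℕ b +_) (begin
           suc k *ℕ suc u *ℕ c              ≡⟨ *-assoc (suc k) (suc u) c ⟩
           suc k *ℕ (suc u *ℕ c)            ≡⟨ cong (suc k *ℕ_) (absorption m u) ⟩
           suc k *ℕ (suc m *ℕ (m C u))      ≡⟨ *.x∙yz≈y∙xz (suc k) (suc m) (m C u) ⟩
           suc m *ℕ (suc k *ℕ (m C u))      ∎) ⟩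
    suc m *ℕ b + suc m *ℕ (suc k *ℕ (m C u))
      ≡⟨ *-distribˡ-+ (suc m) b _ ⟨
    suc m *ℕ (b + suc k *ℕ (m C u))
      ≡⟨ cong₂ _*ℕ_ e (below-binomial m j u e) ⟩
    (j + suc k *ℕ suc u) *ℕ c
      ≡⟨ *-distribʳ-+ c j (suc k *ℕ suc u) ⟩
    j *ℕ c + suc k *ℕ suc u *ℕ c ∎)
    where
    b c : ℕ
    b = below k (suc m) j
    c = suc m C suc u

-- The recursions count actual lists of paths.

-- Quantifying over all deciders frees the count from any particular one, so equivalent predicates
-- can be exchanged.
Counts : Pred Path 0ℓ → ℕ → ℕ → Set
Counts P m c = (P? : Decidable P) → length (filter P? (pathsOfLength m)) ≡ c

counts-resp : ∀ {P Q c} m → P ≐ Q → Counts P m c → Counts Q m c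
counts-resp m (P⊆Q , Q⊆P) cP Q? =
  trans (cong length (filter-≐ Q? P? (Q⊆P , P⊆Q) (pathsOfLength m))) (cP P?)
  where P? = λ w → map′ Q⊆P P⊆Q (Q? w)

counts-none : ∀ {P} m → (∀ w → ¬ P w) → Counts P m 0
counts-none m ¬P P? = cong length (filter-none P? (universal ¬P (pathsOfLength m)))

length-filter-map : ∀ {P : Pred Path 0ℓ} (P? : Decidable P) (f : Path → Path) ws →
  length (filter P? (map f ws)) ≡ length (filter (P? ∘ f) ws)
length-filter-map P? f []       = refl
length-filter-map P? f (w ∷ ws) with does (P? (f w))
... | true  = cong suc (length-filter-map P? f ws)
... | false = length-filter-map P? f ws

counts-suc : ∀ {P a b} m → Counts (P ∘ (right ∷_)) m a → Counts (P ∘ (up ∷_)) m b →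
  Counts P (suc m) (a + b)
counts-suc {a = a} {b} m ca cb P? = begin
  length (filter P? (map (right ∷_) ws ++ map (up ∷_) ws))
    ≡⟨ cong length (filter-++ P? (map (right ∷_) ws) _) ⟩
  length (filter P? (map (right ∷_) ws) ++ filter P? (map (up ∷_) ws))
    ≡⟨ length-++ (filter P? (map (right ∷_) ws)) ⟩
  length (filter P? (map (right ∷_) ws)) + length (filter P? (map (up ∷_) ws))
    ≡⟨ cong₂ _+_ (length-filter-map P? (right ∷_) ws) (length-filter-map P? (up ∷_) ws) ⟩
  length (filter (P? ∘ (right ∷_)) ws) + length (filter (P? ∘ (up ∷_)) ws)
    ≡⟨ cong₂ _+_ (ca (P? ∘ (right ∷_))) (cb (P? ∘ (up ∷_))) ⟩
  a + b ∎
  where ws = pathsOfLength m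

module _ (k n : ℕ) where

  Allowed : Point → Set
  Allowed p = OnLine k p → p ≡ origin ⊎ p ≡ (k *ℕ n , n)

  -- The bridge conditions from an arbitrary starting point, as induction on the steps requires.
  Completes : Point → Pred Path 0ℓ
  Completes p w = foldl move p w ≡ (k *ℕ n , n) × All Allowed (scanl move p w)

  completes-head : ∀ p w → Completes p w → Allowed p
  completes-head p []      (_ , a ∷ _) = a
  completes-head p (s ∷ w) (_ , a ∷ _) = a

  completes-∷ : ∀ p s → Allowed p → Completes (move p s) ≐ (Completes p ∘ (s ∷_))
  completes-∷ p s a = (λ { (e , as) → e , a ∷ as }) , λ { (e , _ ∷ as) → e , as }

  counts-step : ∀ p {a b} m → Allowed p →
    Counts (Completes (move p right)) m a → Counts (Completes (move p up)) m b →
    Counts (Completes p) (suc m) (a + b)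
  counts-step p m allowed ca cb = counts-suc m
    (counts-resp m (completes-∷ p right allowed) ca) (counts-resp m (completes-∷ p up allowed) cb)

  counts-end : ∀ p → p ≢ (k *ℕ n , n) → Counts (Completes p) 0 0
  counts-end p p≢end P? with P? []
  ... | yes (e , _) = contradiction e p≢end
  ... | no  _       = refl

  -- With a positive second coordinate, a point on the line is allowed only as the endpoint, and by
  -- the length equation this happens exactly at m = 0.
  counts-below : ∀ m j x y → x + j ≡ k *ℕ suc y → x + suc y + m ≡ k *ℕ n + n →
    Counts (Completes (x , suc y)) m (below k m j)
  counts-below zero zero x y h l P? =
    cong length (filter-accept P? {xs = []} (at-end , (λ _ → inj₂ at-end) ∷ []))
    where
    x≡ : x ≡ k *ℕ suc y
    x≡ = trans (sym (+-identityʳ x)) h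
    y≡ : suc y ≡ n
    -- On the line the coordinate sum is (k + 1)(y + 1), so it determines y.
    y≡ = *-cancelˡ-≡ (suc y) n (suc k) (begin
      suc y + k *ℕ suc y    ≡⟨ +-comm (suc y) _ ⟩
      k *ℕ suc y + suc y    ≡⟨ cong (_+ suc y) x≡ ⟨
      x + suc y             ≡⟨ +-identityʳ _ ⟨
      x + suc y + 0         ≡⟨ l ⟩
      k *ℕ n + n            ≡⟨ +-comm _ n ⟩
      n + k *ℕ n            ∎)
    at-end : (x , suc y) ≡ (k *ℕ n , n)
    at-end = cong₂ _,_ (trans x≡ (cong (k *ℕ_) y≡)) y≡
  counts-below zero (suc j) x y h l = counts-end _ λ { refl →
    m≢1+m+n (k *ℕ n) (sym (trans (sym (+-suc (k *ℕ n) j)) h)) }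
  counts-below (suc m) zero x y h l = counts-none (suc m) λ w c →
    not-allowed (completes-head _ w c (trans (sym (+-identityʳ x)) h))
    where
    not-allowed : ¬ ((x , suc y) ≡ origin ⊎ (x , suc y) ≡ (k *ℕ n , n))
    not-allowed (inj₂ refl) =
      m≢1+m+n (k *ℕ n + n) (sym (trans (sym (+-suc (k *ℕ n + n) m)) l))
  counts-below (suc m) (suc j) x y h l = counts-step (x , suc y) m off-line
    (counts-below m j (suc x) y (trans (sym (+-suc x j)) h) (trans (sym (+-suc (x + suc y) m)) l))
    (counts-below m (suc j + k) x (suc y)
      (trans (sym (+-assoc x (suc j) k)) (trans (cong (_+ k) h)
        (trans (+-comm _ k) (sym (*-suc k (suc y))))))
      (trans (cong (_+ m) (+-suc x (suc y))) (trans (sym (+-suc (x + suc y) m)) l)))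
    where
    off-line : Allowed (x , suc y)
    off-line e = contradiction (trans e (trans (sym h) (+-suc x j))) (m≢1+m+n x)

  -- Points of positive height are off the line, so both steps are open; `glue` records on which
  -- side an up step lands.
  counts-above : ∀ m h x y → x ≡ k *ℕ y + suc h → x + y + m ≡ k *ℕ n + n →
    Counts (Completes (x , y)) m (above k m h)
  counts-above zero h x y e l = counts-end _ λ { refl →
    m≢1+m+n (k *ℕ n) (trans e (+-suc (k *ℕ n) h)) }
  counts-above (suc m) h x y e l = counts-step (x , y) m off-line
    (counts-above m (suc h) (suc x) y (trans (cong suc e) (sym (+-suc (k *ℕ y) (suc h))))
      (trans (sym (+-suc (x + y) m)) l))
    (crossing k h continue-below continue-above)
    where
    off-line : Allowed (x , y)
    off-line e′ = contradiction (trans (sym e′) (trans e (+-suc (k *ℕ y) h))) (m≢1+m+n (k *ℕ y))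
    l′ : x + suc y + m ≡ k *ℕ n + n
    l′ = trans (cong (_+ m) (+-suc x y)) (trans (sym (+-suc (x + y) m)) l)
    continue-below : ∀ j → suc (h + j) ≡ k → Counts (Completes (x , suc y)) m (below k m j)
    continue-below j r = counts-below m j x y (begin
      x + j                  ≡⟨ cong (_+ j) e ⟩
      k *ℕ y + suc h + j     ≡⟨ +-assoc (k *ℕ y) (suc h) j ⟩
      k *ℕ y + suc (h + j)   ≡⟨ cong (k *ℕ y +_) r ⟩
      k *ℕ y + k             ≡⟨ +-comm _ k ⟩
      k + k *ℕ y             ≡⟨ *-suc k y ⟨
      k *ℕ suc y             ∎) l′
    continue-above : ∀ j → h ≡ k + j → Counts (Completes (x , suc y)) m (above k m j)
    continue-above j r = counts-above m j x (suc y) (begin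
      x                      ≡⟨ e ⟩
      k *ℕ y + suc h         ≡⟨ cong (λ v → k *ℕ y + suc v) r ⟩
      k *ℕ y + suc (k + j)   ≡⟨ rearrange (k *ℕ y) k j ⟩
      k + k *ℕ y + suc j     ≡⟨ cong (_+ suc j) (*-suc k y) ⟨
      k *ℕ suc y + suc j     ∎) l′
      where
      rearrange : ∀ p k j → p + (1 + (k + j)) ≡ k + p + (1 + j)
      rearrange = solve-∀
    -- Follows the recursion of `glue`, in which k′ and h′ decrease together and keep their
    -- difference.
    crossing : ∀ {f g : ℕ → ℕ} k′ h′ →
      (∀ j → suc (h′ + j) ≡ k′ → Counts (Completes (x , suc y)) m (f j)) →
      (∀ j → h′ ≡ k′ + j → Counts (Completes (x , suc y)) m (g j)) →
      Counts (Completes (x , suc y)) m (glue k′ f g h′)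
    crossing zero     h′       cf cg = cg h′ refl
    crossing (suc k′) zero     cf cg = cf k′ refl
    crossing (suc k′) (suc h′) cf cg =
      crossing k′ h′ (λ j r → cf j (cong suc r)) (λ j r → cg j (cong suc r))

-- The closed formula.

-- The first step leads to height 1, which yields k copies of the first passage count, or to height
-- -k, which yields one more.
b̃≡[1+k]*below : ∀ k n → b̃ k (suc n) ≡ suc k *ℕ below k (k *ℕ suc n + n) k
b̃≡[1+k]*below k n = begin
  b̃ k (suc n)
    ≡⟨ cong (λ l → length (filter P? (pathsOfLength l))) (+-suc (k *ℕ suc n) n) ⟩
  length (filter P? (pathsOfLength (suc m)))
    ≡⟨ counts-suc m
         (counts-resp m (first-step right)
           (counts-above k (suc n) m 0 1 0 (sym (cong (_+ 1) (*-zeroʳ k))) l))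
         (counts-resp m (first-step up) (counts-below k (suc n) m k 0 0 (sym (*-identityʳ k)) l))
         P? ⟩
  above k m 0 + below k m k
    ≡⟨ cong (_+ below k m k) (above≡k*below k m) ⟩
  k *ℕ below k m k + below k m k
    ≡⟨ +-comm _ (below k m k) ⟩
  suc k *ℕ below k m k ∎
  where
  m : ℕ
  m = k *ℕ suc n + n
  P? = isMinimalBridge? k (suc n)
  l : suc m ≡ k *ℕ suc n + suc n
  l = sym (+-suc (k *ℕ suc n) n)
  first-step : ∀ s → Completes k (suc n) (move origin s) ≐ (IsMinimalBridge k (suc n) ∘ (s ∷_))
  first-step right = (λ { (e , as) → (λ ()) , e , (λ _ → inj₁ refl) ∷ as })
                   , λ { (_ , e , _ ∷ as) → e , as }
  first-step up    = (λ { (e , as) → (λ ()) , e , (λ _ → inj₁ refl) ∷ as })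
                   , λ { (_ , e , _ ∷ as) → e , as }

-- The formula without division. After the ballot theorem, absorption turns (k + 1) C(m, n) into C(m
-- + 1, n + 1), as (n + 1)(k + 1) = m + 1.
b̃-identity : ∀ k n →
  (k *ℕ suc n + n) *ℕ b̃ k (suc n) ≡ k *ℕ ((k *ℕ suc n + suc n) C suc n)
b̃-identity k n = begin
  m *ℕ b̃ k (suc n)
    ≡⟨ cong (m *ℕ_) (b̃≡[1+k]*below k n) ⟩
  m *ℕ (suc k *ℕ below k m k)
    ≡⟨ *.x∙yz≈y∙xz m (suc k) _ ⟩
  suc k *ℕ (m *ℕ below k m k)
    ≡⟨ cong (suc k *ℕ_) (first-passage k m k n (length-below k n)) ⟩
  suc k *ℕ (k *ℕ (m C n))
    ≡⟨ *.x∙yz≈y∙xz (suc k) k (m C n) ⟩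
  k *ℕ (suc k *ℕ (m C n))
    ≡⟨ cong (k *ℕ_) (*-cancelˡ-≡ _ _ (suc n) (begin
         suc n *ℕ (suc k *ℕ (m C n))   ≡⟨ *-assoc (suc n) (suc k) _ ⟨
         suc n *ℕ suc k *ℕ (m C n)     ≡⟨ cong (_*ℕ (m C n)) (length-suc k n) ⟩
         suc m *ℕ (m C n)              ≡⟨ absorption m n ⟨
         suc n *ℕ (suc m C suc n)      ∎)) ⟩
  k *ℕ (suc m C suc n)
    ≡⟨ cong (λ v → k *ℕ (v C suc n)) (+-suc (k *ℕ suc n) n) ⟨
  k *ℕ ((k *ℕ suc n + suc n) C suc n) ∎
  where
  m : ℕ
  m = k *ℕ suc n + n
  length-below : ∀ k n → k *ℕ (1 + n) + n ≡ k + (1 + k) *ℕ n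
  length-below = solve-∀
  length-suc : ∀ k n → (1 + n) *ℕ (1 + k) ≡ 1 + (k *ℕ (1 + n) + n)
  length-suc = solve-∀

open import Data.Integer using (+_)

-- The comparison is made among unnormalised fractions, whose equality is cross-multiplication by
-- definition.
cross-multiply : ∀ a b c d .{{_ : NonZero d}} → d *ℕ a ≡ b *ℕ c →
  + a / 1 ≡ (+ b / d) * (+ c / 1)
cross-multiply a b c (suc d) e = toℚᵘ-injective (begin-equality
  toℚᵘ (+ a / 1)
    ≃⟨ toℚᵘ-fromℚᵘ (ℚᵘ.mkℚᵘ (+ a) 0) ⟩
  ℚᵘ.mkℚᵘ (+ a) 0
    ≃⟨ ℚᵘ.*≡* cross ⟩
  ℚᵘ.mkℚᵘ (+ b) d ℚᵘ.* ℚᵘ.mkℚᵘ (+ c) 0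
    ≃⟨ ℚᵘ.*-cong (toℚᵘ-fromℚᵘ (ℚᵘ.mkℚᵘ (+ b) d)) (toℚᵘ-fromℚᵘ (ℚᵘ.mkℚᵘ (+ c) 0)) ⟨
  toℚᵘ (+ b / suc d) ℚᵘ.* toℚᵘ (+ c / 1)
    ≃⟨ toℚᵘ-homo-* (+ b / suc d) (+ c / 1) ⟨
  toℚᵘ ((+ b / suc d) * (+ c / 1)) ∎ᵘ)
  where
  open ℚᵘ.≤-Reasoning using (begin-equality_; step-≃-⟩; step-≃-⟨) renaming (_∎ to _∎ᵘ)
  cross : + a ℤ.* + (suc d *ℕ 1) ≡ (+ b ℤ.* + c) ℤ.* + 1
  cross = begin
    + a ℤ.* + (suc d *ℕ 1)    ≡⟨ ℤ.pos-* a (suc d *ℕ 1) ⟨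
    + (a *ℕ (suc d *ℕ 1))     ≡⟨ cong +_ (trans (cong (a *ℕ_) (*-identityʳ (suc d)))
                                             (trans (*-comm a (suc d)) e)) ⟩
    + (b *ℕ c)                ≡⟨ ℤ.pos-* b c ⟩
    + b ℤ.* + c               ≡⟨ ℤ.*-identityʳ _ ⟨
    (+ b ℤ.* + c) ℤ.* + 1     ∎

corollary9 : ∀ (k n : ℕ) .{{_ : NonZero k}} .{{_ : NonZero n}} →
    let instance _ = kn+n∸1≢0 k n in
    + b̃ k n / 1 ≡ (+ k / (k *ℕ n + n ∸ 1)) * (+ ((k *ℕ n + n) C n) / 1)
corollary9 k (suc n) =
  cross-multiply (b̃ k (suc n)) k ((k *ℕ suc n + suc n) C suc n) (k *ℕ suc n + suc n ∸ 1)
    {{kn+n∸1≢0 k (suc n)}}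
    -- Exposing a successor lets `∸ 1` compute.
    (trans (cong (λ l → (l ∸ 1) *ℕ b̃ k (suc n)) (+-suc (k *ℕ suc n) n)) (b̃-identity k n))
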